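{- Consider MALIQUOT. Then, for all $n$, $\mathcal{SG}(n) = \Omega(n)$.
   Context: MALIQUOT is the impartial normal-play game whose positions are the positive integers, where from $n$ a player moves to a proper divisor of $n$, i.e. $\mathrm{opt}(n)=\{d: d\mid n,\ 0<d<n\}$; the player unable to move loses. $\mathcal{SG}$ denotes the Sprague-Grundy (nim-)value, $\mathcal{SG}(n)=\mathrm{mex}\{\mathcal{SG}(x):x\in\mathrm{opt}(n)\}$. $\Omega(n)$ is the number of prime factors of $n$ counted with multiplicity. -}

module Defs where

open import Data.Bool.Base using (if_then_else_)
open import Data.List.Base using (List; filter; length; map; upTo)
open import Data.List.Extrema.Nat using (max; xs≤max)
open import Data.List.Membership.DecPropositional using () renaming (_∈?_ to mem?)
open import Data.List.Membership.Propositional using (_∈_; _∉_; mapWith∈)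
open import Data.List.Membership.Propositional.Properties using (∈-filter⁺; ∈-filter⁻; ∈-upTo⁺; ∈-upTo⁻; mapWith∈-cong; mapWith∈≗map)
open import Data.List.Relation.Unary.All using (lookup)
open import Data.Nat.Base using (ℕ; zero; suc; _+_; _<_; NonZero)
open import Data.Nat.Divisibility using (_∣_; _∣?_)
open import Data.Nat.Induction using (<-rec; <-wellFounded; <-Rec)
open import Data.Nat.Primality.Factorisation using (factorise; factors)
open import Data.Nat.Properties using (_≟_; _<?_; <-irrefl; m<1+n⇒m<n∨m≡n; +-suc; +-identityʳ)
open import Data.Product.Base using (_×_; _,_; proj₁)
open import Data.Sum.Base using (inj₁; inj₂)
open import Function.Bundles using (_⇔_; mk⇔)
open import Induction.WellFounded using (module FixPoint)
open import Relation.Binary.PropositionalEquality using (_≡_; refl; trans; cong; subst)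
open import Relation.Nullary.Decidable using (Dec; does; yes; no; _×-dec_)
open import Relation.Unary using (Decidable)

_∈?_ : (k : ℕ) (xs : List ℕ) → Dec (k ∈ xs)
_∈?_ = mem? _≟_

-- The first of k, k + 1, …, k + fuel absent from xs (k + fuel if the
-- preceding ones are all present).
mexFrom : (k fuel : ℕ) → List ℕ → ℕ
mexFrom k zero       xs = k
mexFrom k (suc fuel) xs = if does (k ∈? xs) then mexFrom (suc k) fuel xs else k

-- The fuel suffices because 1 + max xs is never in xs; see mex-∉ and <mex⇒∈.
mex : List ℕ → ℕ
mex xs = mexFrom 0 (suc (max 0 xs)) xs

mexFrom-∉ : ∀ k fuel xs → k + fuel ∉ xs → mexFrom k fuel xs ∉ xs
mexFrom-∉ k zero       xs k∉ = subst (_∉ xs) (+-identityʳ k) k∉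
mexFrom-∉ k (suc fuel) xs k∉ with k ∈? xs
... | yes _    = mexFrom-∉ (suc k) fuel xs (subst (_∉ xs) (+-suc k fuel) k∉)
... | no  k∉xs = k∉xs

<mexFrom⇒∈ : ∀ k fuel xs → (∀ {j} → j < k → j ∈ xs) → ∀ {j} → j < mexFrom k fuel xs → j ∈ xs
<mexFrom⇒∈ k zero       xs below = below
<mexFrom⇒∈ k (suc fuel) xs below with k ∈? xs
... | no  _    = below
... | yes k∈xs = <mexFrom⇒∈ (suc k) fuel xs below′
  where
  below′ : ∀ {j} → j < suc k → j ∈ xs
  below′ j<1+k with m<1+n⇒m<n∨m≡n j<1+k
  ... | inj₁ j<k  = below j<k
  ... | inj₂ refl = k∈xs

mex-∉ : ∀ xs → mex xs ∉ xs
mex-∉ xs = mexFrom-∉ 0 (suc (max 0 xs)) xs (λ ∈xs → <-irrefl refl (lookup (xs≤max 0 xs) ∈xs))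

<mex⇒∈ : ∀ xs {j} → j < mex xs → j ∈ xs
<mex⇒∈ xs = <mexFrom⇒∈ 0 (suc (max 0 xs)) xs (λ ())

-- Positions are the positive integers; the value at 0 is irrelevant.
opt : ℕ → List ℕ
opt n = filter (λ d → d ∣? n ×-dec 0 <? d) (upTo n)

∈-opt⇒< : ∀ {n d} → d ∈ opt n → d < n
∈-opt⇒< {n} d∈ = ∈-upTo⁻ (proj₁ (∈-filter⁻ (λ d → d ∣? n ×-dec 0 <? d) d∈))

∈-opt⇔ : ∀ {n d} → d ∈ opt n ⇔ (d ∣ n × 0 < d × d < n)
∈-opt⇔ {n} {d} = mk⇔ to from
  where
  option? : Decidable (λ d → d ∣ n × 0 < d)
  option? d = d ∣? n ×-dec 0 <? d

  to : d ∈ opt n → d ∣ n × 0 < d × d < n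
  to d∈ with d∈upTo , d∣n , 0<d ← ∈-filter⁻ option? {xs = upTo n} d∈ = d∣n , 0<d , ∈-upTo⁻ d∈upTo

  from : d ∣ n × 0 < d × d < n → d ∈ opt n
  from (d∣n , 0<d , d<n) = ∈-filter⁺ option? (∈-upTo⁺ d<n) (d∣n , 0<d)

SG-step : ∀ n → <-Rec (λ _ → ℕ) n → ℕ
SG-step n sg = mex (mapWith∈ (opt n) (λ d∈ → sg (∈-opt⇒< d∈)))

-- The defining recursion is SG-unfold.
SG : ℕ → ℕ
SG = <-rec (λ _ → ℕ) SG-step

SG-unfold : ∀ n → SG n ≡ mex (map SG (opt n))
SG-unfold n = trans (unfold-wfRec {n}) (cong mex (mapWith∈≗map SG (opt n)))
  where
  open FixPoint <-wellFounded (λ _ → ℕ) SG-step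
    (λ m eq → cong mex (mapWith∈-cong (opt m) _ _ (λ d∈ → eq (∈-opt⇒< d∈))))

Ω : (n : ℕ) .{{_ : NonZero n}} → ℕ
Ω n = length (factors (factorise n))

{-# OPTIONS --safe #-}
-- The prime factorisation of a proper divisor d of n extends, by a nonempty
-- factorisation of n / d, to one of n, so Ω d < Ω n. Conversely the product of
-- the first k < Ω n prime factors of n is a proper divisor d with Ω d = k.
-- By induction the options of n have exactly the values 0, …, Ω n − 1.
module Submission where

open import Data.Nat.Base using (ℕ; NonZero)
open import Relation.Binary.PropositionalEquality using (_≡_)
open import Defs

open import Data.List.Base using ([]; _∷_; _++_; length; map; take; drop)
open import Data.List.Membership.Propositional using (_∈_; _∉_)
open import Data.List.Membership.Propositional.Properties using (∈-map⁺; ∈-map⁻)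
open import Data.List.Properties using (length-++; length-take; take++drop≡id)
open import Data.List.Relation.Binary.Permutation.Propositional.Properties using (↭-length)
open import Data.List.Relation.Unary.All.Properties using (++⁺; take⁺)
open import Data.Nat.Base using (_+_; _*_; _<_; >-nonZero; z<s)
open import Data.Nat.Divisibility using (_∣_; divides; ∣⇒≤; quotient; quotient>1; m∣n⇒n≡m*quotient)
open import Data.Nat.Induction using (<-rec)
open import Data.Nat.ListAction using (product)
open import Data.Nat.ListAction.Properties using (product-++)
open import Data.Nat.Primality using (productOfPrimes≥1)
open import Data.Nat.Primality.Factorisation using (PrimeFactorisation; factorise; factors; factorisationUnique)
open import Data.Nat.Properties using (<-cmp; <-trans; <⇒≢; <⇒≤; ≤∧≢⇒<; *-comm; m<m+n; m≤n⇒m⊓n≡m)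
open import Data.Product.Base using (∃-syntax; _×_; _,_)
open import Function.Bundles using (Equivalence)
open import Relation.Binary.Definitions using (tri<; tri≈; tri>)
open import Relation.Binary.PropositionalEquality using (refl; sym; trans; cong; cong₂; subst; _≢_; module ≡-Reasoning)
open import Relation.Nullary.Negation using (contradiction)

open PrimeFactorisation using (isFactorisation; factorsPrime)

private
  variable
    m n : ℕ

-- `mex-∉` and `<mex⇒∈` exclude a `mex` above or below `v`, so from here on the search with fuel
-- behind `mex` need not be unfolded.
mex-unique : ∀ xs {v} → v ∉ xs → (∀ {j} → j < v → j ∈ xs) → mex xs ≡ v
mex-unique xs {v} v∉xs below with <-cmp (mex xs) v
... | tri< mex<v _ _ = contradiction (below mex<v) (mex-∉ xs)
... | tri≈ _ mex≡v _ = mex≡v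
... | tri> _ _ v<mex = contradiction (<mex⇒∈ xs v<mex) v∉xs

-- Prime factorisations agree up to permutation. The equation `m ≡ n` is an argument because the
-- numbers compared, such as `d * quotient d∣n` and `n`, are only propositionally equal.
length-factors-unique : m ≡ n → (f : PrimeFactorisation m) (g : PrimeFactorisation n) →
  length (factors f) ≡ length (factors g)
length-factors-unique refl f g = ↭-length (factorisationUnique f g)

factorisation-* : PrimeFactorisation m → PrimeFactorisation n → PrimeFactorisation (m * n)
factorisation-* f g = record
  { factors         = factors f ++ factors g
  ; isFactorisation = trans (cong₂ _*_ (isFactorisation f) (isFactorisation g))
                            (sym (product-++ (factors f) (factors g)))
  ; factorsPrime    = ++⁺ (factorsPrime f) (factorsPrime g)
  }

length-factors>0 : 1 < n → (f : PrimeFactorisation n) → 0 < length (factors f)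
-- Abstracting both fields together turns the second into `n ≡ 1` when the list is empty.
length-factors>0 1<n f with factors f | isFactorisation f
... | []    | n≡1 = contradiction (sym n≡1) (<⇒≢ 1<n)
... | _ ∷ _ | _   = z<s

-- The cofactor of `d` exceeds 1, so it contributes at least one further prime; uniqueness carries
-- the count over to the arbitrary `f`.
properDivisor⇒length-factors-< : ∀ {d} → d ∣ n → d < n → (g : PrimeFactorisation d) (f : PrimeFactorisation n) →
  length (factors g) < length (factors f)
properDivisor⇒length-factors-< d∣n d<n g f = subst (length (factors g) <_) length-g+h≡length-f
  (m<m+n (length (factors g)) (length-factors>0 1<q h))
  where
  1<q = quotient>1 d∣n d<n

  h : PrimeFactorisation (quotient d∣n)
  h = factorise (quotient d∣n) {{>-nonZero (<-trans z<s 1<q)}}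

  length-g+h≡length-f : length (factors g) + length (factors h) ≡ length (factors f)
  length-g+h≡length-f = trans (sym (length-++ (factors g)))
    (length-factors-unique (sym (m∣n⇒n≡m*quotient d∣n)) (factorisation-* g h) f)

-- Any `k` of the primes in `f` would do; taking a prefix leaves the product of the remaining ones
-- as cofactor. The factorisation `g` is returned along with `d`, so its length is known by
-- construction.
∃-properDivisor-length-factors : (f : PrimeFactorisation n) → ∀ {k} → k < length (factors f) →
  ∃[ d ] d ∈ opt n × ∃[ g ] length (factors {d} g) ≡ k
∃-properDivisor-length-factors {n} f {k} k<length =
  d , Equivalence.from ∈-opt⇔ (d∣n , productOfPrimes≥1 (factorsPrime g) , ≤∧≢⇒< d≤n d≢n) , g , length-g≡k
  where
  d = product (take k (factors f))

  g : PrimeFactorisation d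
  g = record
    { factors         = take k (factors f)
    ; isFactorisation = refl
    ; factorsPrime    = take⁺ k (factorsPrime f)
    }

  length-g≡k : length (factors g) ≡ k
  length-g≡k = trans (length-take k (factors f)) (m≤n⇒m⊓n≡m (<⇒≤ k<length))

  d∣n : d ∣ n
  d∣n = divides (product (drop k (factors f))) (begin
    n                                                   ≡⟨ isFactorisation f ⟩
    product (factors f)                                 ≡⟨ cong product (take++drop≡id k (factors f)) ⟨
    product (take k (factors f) ++ drop k (factors f))  ≡⟨ product-++ (take k (factors f)) _ ⟩
    d * product (drop k (factors f))                    ≡⟨ *-comm d _ ⟩
    product (drop k (factors f)) * d                    ∎)
    where open ≡-Reasoning

  n≥1 : 0 < n
  n≥1 = subst (0 <_) (sym (isFactorisation f)) (productOfPrimes≥1 (factorsPrime f))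

  d≤n = ∣⇒≤ {{>-nonZero n≥1}} d∣n

  -- If `d` were `n`, uniqueness would force `k` to equal the full number of prime factors.
  d≢n : d ≢ n
  d≢n d≡n = <⇒≢ k<length (trans (sym length-g≡k) (length-factors-unique d≡n g f))

-- Quantifying over every factorisation lets the induction hypothesis apply to whichever one is at
-- hand. The case of 0 is vacuous, since a product of primes is positive.
SG≡length-factors : ∀ n (f : PrimeFactorisation n) → SG n ≡ length (factors f)
SG≡length-factors = <-rec _ step
  where
  step : ∀ n → (∀ {d} → d < n → (g : PrimeFactorisation d) → SG d ≡ length (factors g)) →
         (f : PrimeFactorisation n) → SG n ≡ length (factors f)
  step n ih f = trans (SG-unfold n) (mex-unique (map SG (opt n)) notAttained attained)
    where
    notAttained : length (factors f) ∉ map SG (opt n)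
    notAttained length∈ with d , d∈opt , length≡SG ← ∈-map⁻ SG length∈
      with d∣n , 0<d , d<n ← Equivalence.to ∈-opt⇔ d∈opt =
      -- By induction the value of the option `d` is its number of prime factors, which is strictly
      -- smaller than that of `n`.
      <⇒≢ (properDivisor⇒length-factors-< d∣n d<n g f) (sym (trans length≡SG (ih d<n g)))
      where g = factorise d {{>-nonZero 0<d}}

    attained : ∀ {k} → k < length (factors f) → k ∈ map SG (opt n)
    attained k<length with d , d∈opt , g , length≡k ← ∃-properDivisor-length-factors f k<length =
      -- The induction hypothesis is used at the prefix factorisation `g` itself, whose length is
      -- `k`.
      subst (_∈ map SG (opt n)) (trans (ih (∈-opt⇒< d∈opt) g) length≡k) (∈-map⁺ SG d∈opt)

mainTheorem1 : (n : ℕ) .{{_ : NonZero n}} → SG n ≡ Ω n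
mainTheorem1 n = SG≡length-factors n (factorise n)
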